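{- Let $F$ be a 4-regular multigraph with Euler systems $C$ and $C'$. Then the relative interlacement matrices satisfy $$\mathcal{I}_{C'}(C)^{ -1}=\mathcal{I}_{C}(C')$$ (in particular, $\mathcal{I}_{C'}(C)$ is invertible over $GF(2)$).
   Context: Multigraphs are finite; in a 4-regular multigraph every vertex has degree 4, and loops and parallel edges are allowed (a loop contributes 2 to the degree of its vertex). Each edge consists of two half-edges, so exactly four half-edges are incident at each vertex. A transition at a vertex $v$ is one of the three ways to sort the four half-edges at $v$ into two disjoint pairs. A circuit is a closed walk with no repeated edge; circuits are considered without preferred starting point or orientation. Choosing one transition at each vertex of $F$ yields a partition of the edge set $E(F)$ into edge-disjoint circuits (consecutive half-edges of a circuit passing through a vertex are those paired by the chosen transition); such a partition, together with its transitions, is a circuit partition $P$ of $F$, and $P$ is said to involve the chosen transition at each vertex. An Euler system is a circuit partition containing exactly one circuit (an Euler circuit, containing every edge of the component) for each connected component of $F$. Interlacement: given an Euler system $C$, two vertices $v\neq w$ are interlaced with respect to $C$ if they appear in the order $v\ldots w\ldots v\ldots w$ on one of the circuits of $C$. The interlacement matrix $\mathcal{I}(C)$ is the $V(F)\times V(F)$ zero-diagonal symmetric matrix over $GF(2)$ whose $vw$ entry ($v\neq w$) is $1$ if and only if $v$ and $w$ are interlaced with respect to $C$. Transition labels with respect to $C$: at a vertex $v$, orient the circuit of $C$ incident at $v$ (either way). The transition followed by $C$ at $v$ is labeled $\phi$; the other transition in which in-directed half-edges are paired with out-directed half-edges is labeled $\chi$; the transition in which the two in-directed half-edges are paired with each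 other and the two out-directed half-edges are paired with each other is labeled $\psi$. Relative interlacement matrix: for a circuit partition $P$ (for instance an Euler system) and an Euler system $C$ of $F$, $\mathcal{I}_P(C)$ is obtained from $\mathcal{I}(C)$ as follows, all labels being with respect to $C$. If $P$ involves the $\phi$ transition at $v$, change every nonzero entry of the row and column corresponding to $v$ to $0$, and change the diagonal entry of $v$ from $0$ to $1$. If $P$ involves the $\psi$ transition at $v$, change the diagonal entry of $v$ from $0$ to $1$. (No change on account of vertices where $P$ involves the $\chi$ transition.) Thus $\mathcal{I}_{C}(C')$ is formed using the interlacement matrix $\mathcal{I}(C')$ and the transition labels with respect to $C'$. -}

module Defs where

open import Algebra.Bundles using (CommutativeRing)
open import Data.Bool.Base using (Bool; if_then_else_; _∨_)
open import Data.Bool.Properties using (xor-∧-commutativeRing)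
open import Data.Fin.Base using (Fin)
open import Data.Fin.Properties using (_≟_; any?; all?)
open import Data.List.Base using (List; []; _∷_; map; filter; length; allFin; iterate; takeWhile)
open import Data.List.Membership.Propositional using (_∈_)
open import Data.List.Relation.Binary.Sublist.Propositional using (_⊆_)
open import Data.Nat.Base using (ℕ)
open import Data.Product.Base using (∃-syntax; _×_)
open import Data.Sum.Base using (_⊎_)
open import Relation.Binary.Construct.Closure.ReflexiveTransitive using (Star)
open import Relation.Binary.PropositionalEquality using (_≡_; _≢_)
open import Relation.Nullary.Decidable using (Dec; does; ¬?; _×-dec_; _→-dec_)
import Algebra.Properties.Semiring.Sum as Sum
import Data.List.Membership.DecPropositional as DecMembership
import Data.List.Relation.Binary.Sublist.DecPropositional as DecSublist

------------------------------------------------------------------------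
-- Multigraphs

-- An edge is an orbit {h , opp h} of the involution `opp` on half-edges;
-- it is a loop when both halves are incident at the same vertex.

record Multigraph : Set where
  field
    nV nH           : ℕ
    end             : Fin nH → Fin nV
    opp             : Fin nH → Fin nH
    opp-involutive  : ∀ h → opp (opp h) ≡ h
    opp-irreflexive : ∀ h → opp h ≢ h

  Vertex : Set
  Vertex = Fin nV

  HalfEdge : Set
  HalfEdge = Fin nH

  degree : Vertex → ℕ
  degree v = length (filter (λ h → end h ≟ v) (allFin nH))

  Adjacent : Vertex → Vertex → Set
  Adjacent v w = ∃[ h ] (end h ≡ v × end (opp h) ≡ w)

  Connected : Vertex → Vertex → Set
  Connected = Star Adjacent

FourRegular : Multigraph → Set
FourRegular F = ∀ v → degree v ≡ 4
  where open Multigraph F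

------------------------------------------------------------------------
-- Circuit partitions

-- A circuit partition is given by its transitions, which determine its
-- circuits: `mate h` is the half-edge paired with h at the vertex end h.

record CircuitPartition (F : Multigraph) : Set where
  open Multigraph F
  field
    mate             : HalfEdge → HalfEdge
    mate-end         : ∀ h → end (mate h) ≡ end h
    mate-involutive  : ∀ h → mate (mate h) ≡ h
    mate-irreflexive : ∀ h → mate h ≢ h

  -- Leave a vertex along h, arrive along opp h, and continue with the
  -- half-edge paired with opp h.

  next : HalfEdge → HalfEdge
  next h = mate (opp h)

  -- The circuit that leaves end h along h, as the cyclic list of its
  -- out-directed half-edges.  As `next` is a permutation, h recurs after at
  -- most nH steps, so the bound never cuts the circuit short.

  tour : HalfEdge → List HalfEdge
  tour h = h ∷ takeWhile (λ x → ¬? (x ≟ h)) (iterate next (next h) nH)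

  OutDirected : HalfEdge → HalfEdge → Set
  OutDirected s h = h ∈ tour s

  InDirected : HalfEdge → HalfEdge → Set
  InDirected s h = opp h ∈ tour s

  -- The edges of h and k lie on the same (unoriented) circuit.

  SameCircuit : HalfEdge → HalfEdge → Set
  SameCircuit h k = OutDirected h k ⊎ InDirected h k

  -- v … w … v … w on a circuit, read from some starting half-edge.

  Interlaced : Vertex → Vertex → Set
  Interlaced v w =
    v ≢ w × (∃[ s ] (v ∷ w ∷ v ∷ w ∷ []) ⊆ map end (tour s))

  outDirected? : ∀ s h → Dec (OutDirected s h)
  outDirected? s h = DecMembership._∈?_ _≟_ h (tour s)

  inDirected? : ∀ s h → Dec (InDirected s h)
  inDirected? s h = DecMembership._∈?_ _≟_ (opp h) (tour s)

  interlaced? : ∀ v w → Dec (Interlaced v w)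
  interlaced? v w =
    ¬? (v ≟ w) ×-dec
    any? (λ s → DecSublist._⊆?_ _≟_ (v ∷ w ∷ v ∷ w ∷ []) (map end (tour s)))

-- Every component contains one and only one circuit.

EulerSystem : ∀ {F} → CircuitPartition F → Set
EulerSystem {F} C =
  ∀ v → ∃[ h ] (Connected v (end h) ×
                (∀ k → Connected v (end k) → SameCircuit h k))
  where
  open Multigraph F
  open CircuitPartition C

------------------------------------------------------------------------
-- Transition labels with respect to C of the transitions involved in P

module _ {F : Multigraph} (C P : CircuitPartition F) where
  open Multigraph F
  open CircuitPartition C using (OutDirected; InDirected; outDirected?; inDirected?)
  private
    module C = CircuitPartition C
    module P = CircuitPartition P

  Involvesφ : Vertex → Set
  Involvesφ v = ∀ h → end h ≡ v → P.mate h ≡ C.mate h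

  -- A half-edge s at v fixes an orientation of the circuit incident at v,
  -- the one leaving v along s; both orientations arise in this way.

  Involvesψ : Vertex → Set
  Involvesψ v = ∀ s → end s ≡ v → ∀ h → end h ≡ v →
    (OutDirected s h → OutDirected s (P.mate h)) ×
    (InDirected  s h → InDirected  s (P.mate h))

  involvesφ? : ∀ v → Dec (Involvesφ v)
  involvesφ? v = all? λ h → (end h ≟ v) →-dec (P.mate h ≟ C.mate h)

  involvesψ? : ∀ v → Dec (Involvesψ v)
  involvesψ? v = all? λ s → (end s ≟ v) →-dec (all? λ h → (end h ≟ v) →-dec
    ((outDirected? s h →-dec outDirected? s (P.mate h)) ×-dec
     (inDirected?  s h →-dec inDirected?  s (P.mate h))))

------------------------------------------------------------------------
-- Matrices over GF(2)

GF2 : CommutativeRing _ _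
GF2 = xor-∧-commutativeRing

open CommutativeRing GF2 using (Carrier; 0#; 1#; _*_; semiring)
open Sum semiring using (sum)

Matrix : ℕ → Set
Matrix n = Fin n → Fin n → Carrier

infixl 7 _⊗_

_⊗_ : ∀ {n} → Matrix n → Matrix n → Matrix n
(A ⊗ B) i k = sum λ j → A i j * B j k

𝟙 : ∀ {n} → Matrix n
𝟙 i j = if does (i ≟ j) then 1# else 0#

infix 4 _≐_

_≐_ : ∀ {n} → Matrix n → Matrix n → Set
A ≐ B = ∀ i j → A i j ≡ B i j

IsInverse : ∀ {n} → Matrix n → Matrix n → Set
IsInverse A B = A ⊗ B ≐ 𝟙 × B ⊗ A ≐ 𝟙

------------------------------------------------------------------------
-- Interlacement matrices

module _ {F : Multigraph} where
  open Multigraph F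

  interlacement : CircuitPartition F → Matrix nV
  interlacement C v w =
    if does (CircuitPartition.interlaced? C v w) then 1# else 0#

  -- 𝓘[ P ] C is the paper's 𝓘_P(C).

  𝓘[_] : CircuitPartition F → CircuitPartition F → Matrix nV
  𝓘[ P ] C v w =
    if does (v ≟ w)
    then (if φ v ∨ ψ v then 1# else interlacement C v v)
    else (if φ v ∨ φ w then 0# else interlacement C v w)
    where
    φ ψ : Vertex → Bool
    φ u = does (involvesφ? C P u)
    ψ u = does (involvesψ? C P u)

{-# OPTIONS --safe #-}
module Submission where

-- Each Euler circuit C cuts itself at a vertex v into two closed segments.
-- Let f v be the GF(2)-valued indicator of the edges of one of them, read on
-- half-edges.  For a transition that pairs the half-edges of a vertex w, let
-- the value of f v on it be f v h + f v k, where h and k are paired.  This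
-- does not depend on the pair, because a segment meets every vertex in an
-- even number of half-edges.  The values of f v are as follows.
--
--   * On the transition of C at w the value is 1 when v = w and 0 otherwise:
--     walking along C, one changes segment exactly when passing v
--     (`seg-mate`).
--   * On any other transition at w with v ≠ w the value is 1 exactly when C
--     passes w once in each segment, that is, when v and w are interlaced.
--   * At v itself the value is 1 on the ψ transition and 0 on χ.
--
-- So when P does not involve the φ transition at v, the row of v in 𝓘[ P ] C
-- lists the values of f v on the transitions of P (`seg-transition`).
--
-- Now let f′ be the family obtained from a second Euler system C′, let
-- M = 𝓘[ C′ ] C and M′ = 𝓘[ C ] C′, and let C′ not follow φ at v.  Consider
--
--   g = f v + Σ_w M v w · f′ w.
--
-- By the above, g has the value 0 on every transition of C′, so g is constant
-- along each circuit of C′.  All half-edges at a vertex lie on one circuit of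
-- C′, so g is constant at each vertex and also has the value 0 on every
-- transition of C.  At a vertex u this reads δ(v , u) = Σ_w M v w · M′ w u:
-- where C and C′ share a transition at w the row of M′ is not a row of values
-- of f′ w, but there M v w = 0.  Hence row v of M ⊗ M′ is the unit row
-- (`product-row`).  If C and C′ share their transition at v, row v is a unit
-- row in both matrices.  Exchanging C and C′ gives the other product.

open import Defs
open import Algebra.Bundles using (CommutativeRing)
open import Data.Bool.Base using (Bool; true; false; _∧_; _∨_; _xor_; if_then_else_)
open import Data.Bool.Properties
  using (∨-comm; ∧-zeroʳ; ∧-identityʳ; ∧-distribˡ-xor;
         xor-assoc; xor-comm; xor-same; xor-identityʳ; ¬-not)
open import Data.Fin.Base using (Fin; zero; suc; toℕ)
open import Data.Fin.Properties using (_≟_; injective⇒≤; pigeonhole; suc-injective; toℕ<n)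
open import Data.List.Base as List
  using (List; []; _∷_; _++_; map; filter; length; allFin; takeWhile; lookup)
open import Data.List.Properties using (length-++; map-++)
open import Data.List.Membership.Propositional using (_∈_; _∉_; find)
open import Data.List.Membership.Propositional.Properties
  using (∈-∃++; ∈-++⁺ˡ; ∈-++⁺ʳ; ∈-++⁻; ∈-filter⁺; ∈-filter⁻; ∈-allFin; ∈-lookup; ∈-map⁺)
open import Data.List.Membership.Setoid.Properties using (index-injective)
open import Data.List.Relation.Binary.Sublist.Propositional using (_⊆_; _∷_; _∷ʳ_; from∈)
open import Data.List.Relation.Binary.Sublist.Propositional.Properties using (++⁺)
open import Data.List.Relation.Unary.All as All using (All; []; _∷_)
open import Data.List.Relation.Unary.All.Properties.Core using (¬All⇒Any¬)
open import Data.List.Relation.Unary.AllPairs using ([]; _∷_)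
open import Data.List.Relation.Unary.Any using (here; there; index)
open import Data.List.Relation.Unary.Unique.Propositional using (Unique)
open import Data.List.Relation.Unary.Unique.Propositional.Properties
  using (Unique[x∷xs]⇒x∉xs; allFin⁺; filter⁺)
open import Data.Nat.Base using (zero; suc; _+_; _≤_; _<_; s≤s; s<s⁻¹)
open import Data.Nat.GeneralisedArithmetic using (iterate)
open import Data.Nat.Properties
  using (m≤n+m; ≤-trans; +-suc; 1+n≰n; m≤n⇒∃[o]m+o≡n; ≤-reflexive; n<1+n; ≤-pred)
open import Data.Product.Base using (∃-syntax; _×_; _,_; proj₁; proj₂)
open import Data.Sum.Base using (_⊎_; inj₁; inj₂)
open import Function.Base using (_∘_)
open import Relation.Binary.Construct.Closure.ReflexiveTransitive using (ε)
open import Relation.Binary.PropositionalEquality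
  using (_≡_; _≢_; refl; sym; trans; cong; cong₂; subst; subst₂; setoid; module ≡-Reasoning)
open import Relation.Nullary using (¬_; yes; no; contradiction)
open import Relation.Nullary.Decidable using (Dec; does; dec-true; dec-false; map′; ¬?)
import Algebra.Properties.Semiring.Sum as Sum
import Data.List.Membership.DecPropositional as DecMembership

open CommutativeRing GF2 using (semiring)
open import Algebra.Properties.CommutativeSemigroup
  (CommutativeRing.+-commutativeSemigroup GF2) using (interchange)
open Sum semiring using (sum; sum-cong-≗; ∑-distrib-+)

private variable
  A B : Set

------------------------------------------------------------------------
-- Lists

unique-lookup-injective : {xs : List A} → Unique xs →
  ∀ {i j} → lookup xs i ≡ lookup xs j → i ≡ j
unique-lookup-injective (_ ∷ _) {zero}  {zero}  _  = refl
unique-lookup-injective {xs = _ ∷ xs} (x∉ ∷ _) {zero} {suc j} eq =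
  contradiction eq (All.lookup x∉ (∈-lookup j))
unique-lookup-injective {xs = _ ∷ xs} (x∉ ∷ _) {suc i} {zero} eq =
  contradiction (sym eq) (All.lookup x∉ (∈-lookup i))
unique-lookup-injective (_ ∷ u) {suc i} {suc j} eq =
  cong suc (unique-lookup-injective u eq)

unique-length-≤ : {xs ys : List A} → Unique xs → (∀ {x} → x ∈ xs → x ∈ ys) →
  length xs ≤ length ys
unique-length-≤ {A = A} {xs} u sub = injective⇒≤ {f = λ i → index (sub (∈-lookup {xs = xs} i))} λ eq →
  unique-lookup-injective u (index-injective (setoid A) (sub (∈-lookup _)) (sub (∈-lookup _)) eq)

unique-++-∉ : (xs : List A) {y : A} {ys : List A} → Unique (xs ++ y ∷ ys) →
  y ∉ xs × y ∉ ys × Unique ys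
unique-++-∉ [] u@(_ ∷ u′) = (λ ()) , Unique[x∷xs]⇒x∉xs u , u′
unique-++-∉ (x ∷ xs) (x∉ ∷ u) with unique-++-∉ xs u
... | y∉xs , y∉ys , u′ =
  (λ { (here refl) → All.lookup x∉ (∈-++⁺ʳ xs (here refl)) refl
     ; (there y∈) → y∉xs y∈ }) , y∉ys , u′

-- A sublist of the image lifts its head to an entry of the list, and its tail
-- to what follows that entry.
∷-⊆-map : (f : A → B) {b : B} {bs : List B} (xs : List A) → b ∷ bs ⊆ map f xs →
  ∃[ ys ] ∃[ x ] ∃[ zs ] (xs ≡ ys ++ x ∷ zs × f x ≡ b × bs ⊆ map f zs)
∷-⊆-map f (x ∷ xs) (eq ∷ sub) = [] , x , xs , refl , sym eq , sub
∷-⊆-map f (x ∷ xs) (_ ∷ʳ sub) with ∷-⊆-map f xs sub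
... | ys , y , zs , refl , eq , sub′ = x ∷ ys , y , zs , refl , eq , sub′

∈-++-⊆-map : (f : A → B) {x : A} (xs : List A) {ys : List A} {bs : List B} →
  x ∈ xs → bs ⊆ map f ys → f x ∷ bs ⊆ map f (xs ++ ys)
∈-++-⊆-map f xs {ys} x∈ sub =
  subst (_ ⊆_) (sym (map-++ f xs ys)) (++⁺ (from∈ (∈-map⁺ f x∈)) sub)

------------------------------------------------------------------------
-- Sums over GF(2)

sum-false : ∀ {n} {g : Fin n → Bool} → (∀ i → g i ≡ false) → sum g ≡ false
sum-false {zero}  eq = refl
sum-false {suc n} eq = cong₂ _xor_ (eq zero) (sum-false (eq ∘ suc))

sum-single : ∀ {n} (g : Fin n → Bool) i → (∀ j → j ≢ i → g j ≡ false) → sum g ≡ g i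
sum-single g zero    eq =
  trans (cong (g zero xor_) (sum-false λ j → eq (suc j) λ ())) (xor-identityʳ _)
sum-single g (suc i) eq = trans (cong (_xor sum (g ∘ suc)) (eq zero λ ()))
  (sum-single (g ∘ suc) i λ j j≢i → eq (suc j) (j≢i ∘ suc-injective))

xor-cancelʳ : ∀ x y → (x xor y) xor y ≡ x
xor-cancelʳ x y = trans (xor-assoc x y y) (trans (cong (x xor_) (xor-same y)) (xor-identityʳ x))

if-id : ∀ b → (if b then true else false) ≡ b
if-id true  = refl
if-id false = refl

entry-true : {P : Set} (P? : Dec P) → P → (if does P? then true else false) ≡ true
entry-true P? p = cong (if_then true else false) (dec-true P? p)

entry-false : {P : Set} (P? : Dec P) → ¬ P → (if does P? then true else false) ≡ false
entry-false P? ¬p = cong (if_then true else false) (dec-false P? ¬p)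

------------------------------------------------------------------------
-- Half-edges at a vertex of degree four

module Valency (F : Multigraph) (regular : FourRegular F) where
  open Multigraph F
  open DecMembership (_≟_ {nH}) using (_∈?_)

  private
    star : Vertex → List HalfEdge
    star v = filter (λ h → end h ≟ v) (allFin nH)

    ∈-star : ∀ {h v} → end h ≡ v → h ∈ star v
    ∈-star {h} {v} eq = ∈-filter⁺ (λ h → end h ≟ v) (∈-allFin h) eq

    star-end : ∀ {h v} → h ∈ star v → end h ≡ v
    star-end {h} {v} h∈ = proj₂ (∈-filter⁻ (λ h → end h ≟ v) {xs = allFin nH} h∈)

  at-most-four : ∀ {v hs} → Unique hs → All (λ h → end h ≡ v) hs → length hs ≤ 4
  at-most-four {v} u ends = subst (_ ≤_) (regular v)
    (unique-length-≤ u λ h∈ → ∈-star (All.lookup ends h∈))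

  halfEdgeAt : ∀ v → ∃[ h ] end h ≡ v
  halfEdgeAt v = go (star v) (regular v) star-end
    where
    go : ∀ hs → length hs ≡ 4 → (∀ {h} → h ∈ hs → end h ≡ v) → ∃[ h ] end h ≡ v
    go (h ∷ _) _ ends = h , ends (here refl)

  -- A half-edge at the vertex of h other than h and k.
  thirdHalfEdge : ∀ h k → ∃[ l ] (end l ≡ end h × l ≢ h × l ≢ k)
  thirdHalfEdge h k with All.all? among? (star (end h))
    where
    among? : ∀ l → Dec (l ∈ h ∷ k ∷ [])
    among? l = l ∈? h ∷ k ∷ []
  ... | yes all∈ = contradiction
    (subst (_≤ 2) (regular (end h)) (unique-length-≤ (filter⁺ _ (allFin⁺ nH)) (All.lookup all∈)))
    λ { (s≤s (s≤s ())) }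
  ... | no ¬all∈ with find (¬All⇒Any¬ (_∈? h ∷ k ∷ []) (star (end h)) ¬all∈)
  ... | l , l∈ , l∉ = l , star-end l∈ , l∉ ∘ here , l∉ ∘ there ∘ here

------------------------------------------------------------------------
-- Circuits

module Circuits {F : Multigraph} (C : CircuitPartition F) where
  open Multigraph F
  open CircuitPartition C

  opp-injective : ∀ {h k} → opp h ≡ opp k → h ≡ k
  opp-injective {h} {k} eq = trans (sym (opp-involutive h)) (trans (cong opp eq) (opp-involutive k))

  mate-injective : ∀ {h k} → mate h ≡ mate k → h ≡ k
  mate-injective {h} {k} eq = trans (sym (mate-involutive h)) (trans (cong mate eq) (mate-involutive k))

  next-injective : ∀ {h k} → next h ≡ next k → h ≡ k
  next-injective eq = opp-injective (mate-injective eq)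

  next-opp : ∀ h → next (opp h) ≡ mate h
  next-opp h = cong mate (opp-involutive h)

  next-opp-next : ∀ h → next (opp (next h)) ≡ opp h
  next-opp-next h = trans (next-opp (next h)) (mate-involutive (opp h))

  infix 4 _↝_

  -- k lies on the directed circuit that leaves along h.
  _↝_ : HalfEdge → HalfEdge → Set
  h ↝ k = ∃[ n ] iterate next h n ≡ k

  -- `iterate` applies its function innermost first; this pulls out the last step.
  iterate-next : ∀ n h → iterate next (next h) n ≡ next (iterate next h n)
  iterate-next zero    h = refl
  iterate-next (suc n) h = iterate-next n (next h)

  iterate-cancel : ∀ i d h → iterate next h i ≡ iterate next h (i + suc d) →
                   h ≡ iterate next (next h) d
  iterate-cancel zero    d h eq = eq
  iterate-cancel (suc i) d h eq = next-injective
    (trans (iterate-cancel i d (next h) eq) (iterate-next d (next h)))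

  -- The permutation `next` returns to h after suc d steps, at most nH of them, by
  -- the pigeonhole principle.
  recurrence : ∀ h → ∃[ d ] (d < nH × iterate next (next h) d ≡ h)
  recurrence h with pigeonhole (n<1+n nH) (λ i → iterate next h (toℕ i))
  ... | i , j , i<j , eq with m≤n⇒∃[o]m+o≡n i<j
  ... | d , 1+i+d≡j = d , d<nH , sym (iterate-cancel (toℕ i) d h
          (trans eq (cong (iterate next h) (sym i+1+d≡j))))
    where
    i+1+d≡j : toℕ i + suc d ≡ toℕ j
    i+1+d≡j = trans (+-suc (toℕ i) d) 1+i+d≡j
    d<nH : d < nH
    d<nH = ≤-trans (m≤n+m (suc d) (toℕ i)) (≤-trans (≤-reflexive i+1+d≡j) (≤-pred (toℕ<n j)))

  ↝-refl : ∀ {h} → h ↝ h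
  ↝-refl = 0 , refl

  ↝-next : ∀ {h} → h ↝ next h
  ↝-next = 1 , refl

  ↝-trans : ∀ {h k l} → h ↝ k → k ↝ l → h ↝ l
  ↝-trans (zero  , refl) k↝l = k↝l
  ↝-trans (suc n , eq)   k↝l with ↝-trans (n , eq) k↝l
  ... | m , eq′ = suc m , eq′

  next-↝ : ∀ {h} → next h ↝ h
  next-↝ {h} = let d , _ , eq = recurrence h in d , eq

  ↝-sym : ∀ {h k} → h ↝ k → k ↝ h
  ↝-sym (zero  , refl) = ↝-refl
  ↝-sym (suc n , eq)   = ↝-trans (↝-sym (n , eq)) next-↝

  -- Reversing a circuit: opp conjugates `next` to its inverse.
  ↝-opp : ∀ {h k} → h ↝ k → opp h ↝ opp k
  ↝-opp (zero , refl) = ↝-refl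
  ↝-opp {h} (suc n , eq) = ↝-trans (↝-sym (1 , next-opp-next h)) (↝-opp (n , eq))

  opp↝mate : ∀ {h} → opp h ↝ mate h
  opp↝mate {h} = 1 , next-opp h

  ↝-mate : ∀ {h k} → h ↝ k → mate h ↝ mate k
  ↝-mate h↝k = ↝-trans (↝-sym opp↝mate) (↝-trans (↝-opp h↝k) opp↝mate)

  -- No circuit traverses an edge in both directions.  A walk along `next` from h
  -- to opp h can be shortened by a step at both ends, down to length 0 or 1,
  -- where opp or mate would have a fixed point.
  ¬↝opp : ∀ {h} → ¬ h ↝ opp h
  ¬↝opp (n , eq) = go n _ eq
    where
    go : ∀ n h → iterate next h n ≢ opp h
    go zero          h eq = opp-irreflexive h (sym eq)
    go (suc zero)    h eq = mate-irreflexive (opp h) eq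
    go (suc (suc n)) h eq = go n (next h) (next-injective
      (trans (sym (iterate-next n (next h))) (trans eq (sym (next-opp-next h)))))

  ¬↝mate : ∀ {h} → ¬ h ↝ mate h
  ¬↝mate h↝mate = ¬↝opp (↝-trans h↝mate (↝-sym opp↝mate))

  -- Path h hs k: following `next` from h, the half-edges hs are traversed and k
  -- comes next.  The endpoint k is not listed, so tour s is a path from s to s.
  data Path : HalfEdge → List HalfEdge → HalfEdge → Set where
    []  : ∀ {h} → Path h [] h
    _∷_ : ∀ h {hs k} → Path (next h) hs k → Path h (h ∷ hs) k

  path-split : ∀ {h} hs {k ks l} → Path h (hs ++ k ∷ ks) l →
               Path h hs k × Path (next k) ks l
  path-split []       (h ∷ p) = [] , p
  path-split (_ ∷ hs) (h ∷ p) = let q , r = path-split hs p in h ∷ q , r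

  path-∈ : ∀ {h hs k l} → Path h hs k → l ∈ hs → h ↝ l
  path-∈ (h ∷ p) (here refl) = ↝-refl
  path-∈ (h ∷ p) (there l∈)  = ↝-trans ↝-next (path-∈ p l∈)

  path-next : ∀ {h hs k l} → Path h (h ∷ hs) k → l ∈ h ∷ hs → next l ∈ hs ⊎ next l ≡ k
  path-next (h ∷ [])      (here refl) = inj₂ refl
  path-next (h ∷ (_ ∷ p)) (here refl) = inj₁ (here refl)
  path-next (h ∷ p@(_ ∷ _)) (there l∈) with path-next p l∈
  ... | inj₁ n∈ = inj₁ (there n∈)
  ... | inj₂ eq = inj₂ eq

  -- Two paths from h that stop on first reaching k agree.
  path-det : ∀ {h hs ks k} → Path h hs k → Path h ks k → k ∉ hs → k ∉ ks → hs ≡ ks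
  path-det []      []      _ _ = refl
  path-det []      (_ ∷ _) _ k∉ = contradiction (here refl) k∉
  path-det (_ ∷ _) []      k∉ _ = contradiction (here refl) k∉
  path-det (h ∷ p) (_ ∷ q) k∉ k∉′ = cong (h ∷_) (path-det p q (k∉ ∘ there) (k∉′ ∘ there))

  -- A repetition h … h would give two different paths from h that stop on first
  -- reaching k.
  path-unique : ∀ {h hs k} → Path h hs k → k ∉ hs → Unique hs
  path-unique [] k∉ = []
  path-unique {hs = _ ∷ hs} {k} (h ∷ p) k∉ = All.tabulate h≢ ∷ path-unique p (k∉ ∘ there)
    where
    h≢ : ∀ {l} → l ∈ hs → h ≢ l
    h≢ l∈ refl with ∈-∃++ l∈
    ... | xs , ys , refl = 1+n≰n (subst (suc (length ys) ≤_) too-long (m≤n+m _ (length xs)))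
      where
      loop : xs ++ h ∷ ys ≡ ys
      loop = path-det p (proj₂ (path-split xs p)) (k∉ ∘ there) (k∉ ∘ there ∘ ∈-++⁺ʳ xs ∘ there)
      too-long : length xs + suc (length ys) ≡ length ys
      too-long = trans (sym (length-++ xs)) (cong length loop)

  private
    takeWhile-path : ∀ m {h d s} → d < m → iterate next h d ≡ s →
      let hs = takeWhile (λ x → ¬? (x ≟ s)) (List.iterate next h m) in
      Path h hs s × s ∉ hs
    takeWhile-path (suc m) {h} {d} {s} d<m eq with h ≟ s
    takeWhile-path (suc m) d<m eq | yes refl = [] , λ ()
    takeWhile-path (suc m) {d = zero} d<m eq | no h≢s = contradiction eq h≢s
    takeWhile-path (suc m) {h} {suc d} d<m eq | no h≢s with takeWhile-path m (s<s⁻¹ d<m) eq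
    ... | p , s∉ = h ∷ p , λ { (here eq′) → h≢s (sym eq′) ; (there s∈) → s∉ s∈ }

    tour-tail : ∀ s → Path (next s) (List.drop 1 (tour s)) s × s ∉ List.drop 1 (tour s)
    tour-tail s = let _ , d<nH , eq = recurrence s in takeWhile-path nH d<nH eq

  tour-path : ∀ s → Path s (tour s) s
  tour-path s = s ∷ proj₁ (tour-tail s)

  tour-unique : ∀ s → Unique (tour s)
  tour-unique s = let p , s∉ = tour-tail s in
    All.tabulate (λ { l∈ refl → s∉ l∈ }) ∷ path-unique p s∉

  ∈tour⇒↝ : ∀ {s h} → h ∈ tour s → s ↝ h
  ∈tour⇒↝ = path-∈ (tour-path _)

  ↝⇒∈tour : ∀ {s h} → s ↝ h → h ∈ tour s
  ↝⇒∈tour {s} (n , eq) = go n (here refl) eq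
    where
    go : ∀ n {k h} → k ∈ tour s → iterate next k n ≡ h → h ∈ tour s
    go zero    k∈ refl = k∈
    go (suc n) k∈ eq with path-next (tour-path s) k∈
    ... | inj₁ n∈  = go n (there n∈) eq
    ... | inj₂ n≡s = go n (here n≡s) eq

------------------------------------------------------------------------
-- Circuits at a vertex of degree four

module RegularCircuits (F : Multigraph) (regular : FourRegular F) (C : CircuitPartition F) where
  open Multigraph F
  open CircuitPartition C
  open Circuits C
  open Valency F regular

  mate-cong-≢ : ∀ {h k} → h ≢ k → mate h ≢ mate k
  mate-cong-≢ h≢k = h≢k ∘ mate-injective

  mate-swap-≢ : ∀ {h k} → h ≢ mate k → mate h ≢ k
  mate-swap-≢ {h} h≢ refl = h≢ (sym (mate-involutive h))

  -- The half-edges at a vertex of degree four are h, mate h, k and mate k, so one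
  -- that differs from the first three is the last.
  fourth : ∀ {h k l} → end k ≡ end h → end l ≡ end h → k ≢ h → k ≢ mate h →
         l ≢ h → l ≢ mate h → l ≢ k → l ≡ mate k
  fourth {h} {k} {l} k-end l-end k≢h k≢mh l≢h l≢mh l≢k with l ≟ mate k
  ... | yes eq  = eq
  ... | no l≢mk = contradiction (at-most-four unique ends) 1+n≰n
    where
    unique : Unique (l ∷ k ∷ mate k ∷ h ∷ mate h ∷ [])
    unique = (l≢k ∷ l≢mk ∷ l≢h ∷ l≢mh ∷ [])
      ∷ (mate-irreflexive k ∘ sym ∷ k≢h ∷ k≢mh ∷ [])
      ∷ (mate-swap-≢ k≢mh ∷ mate-cong-≢ k≢h ∷ [])
      ∷ (mate-irreflexive h ∘ sym ∷ [])
      ∷ [] ∷ []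
    ends : All (λ x → end x ≡ end h) (l ∷ k ∷ mate k ∷ h ∷ mate h ∷ [])
    ends = l-end ∷ k-end ∷ trans (mate-end k) k-end ∷ refl ∷ mate-end h ∷ []

  -- A directed circuit leaves a vertex at most twice: since h and mate h point in
  -- opposite directions, of h, mate h, k and mate k only h and k are on it.
  outs-at-most-two : ∀ {h k l} → end k ≡ end h → end l ≡ end h → h ↝ k → h ↝ l →
                     k ≢ h → l ≢ h → l ≡ k
  outs-at-most-two {h} {k} {l} k-end l-end h↝k h↝l k≢h l≢h with l ≟ k
  ... | yes eq = eq
  ... | no l≢k = contradiction
    (subst (k ↝_) (fourth k-end l-end k≢h (λ { refl → ¬↝mate h↝k }) l≢h (λ { refl → ¬↝mate h↝l }) l≢k)
      (↝-trans (↝-sym h↝k) h↝l))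
    ¬↝mate

------------------------------------------------------------------------
-- Segments of an Euler circuit

module Eulerian (F : Multigraph) (regular : FourRegular F)
                (C : CircuitPartition F) (euler : EulerSystem C) where
  open Multigraph F
  open CircuitPartition C
  open Circuits C
  open Valency F regular
  open RegularCircuits F regular C
  open DecMembership (_≟_ {nH}) using (_∈?_)

  -- All half-edges at a vertex lie on one circuit of an Euler system, up to
  -- orientation.
  same-or-opposite : ∀ {h k} → end k ≡ end h → h ↝ k ⊎ h ↝ opp k
  same-or-opposite {h} {k} k-end with euler (end h)
  ... | r , _ , circuit
    with circuit h ε | circuit k (subst (λ v → Connected (end h) v) (sym k-end) ε)
  ... | inj₁ h∈ | inj₁ k∈ = inj₁ (↝-trans (↝-sym (∈tour⇒↝ h∈)) (∈tour⇒↝ k∈))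
  ... | inj₁ h∈ | inj₂ k∈ = inj₂ (↝-trans (↝-sym (∈tour⇒↝ h∈)) (∈tour⇒↝ k∈))
  ... | inj₂ h∈ | inj₁ k∈ = inj₂ (subst (_↝ opp k) (opp-involutive h)
    (↝-opp (↝-trans (↝-sym (∈tour⇒↝ h∈)) (∈tour⇒↝ k∈))))
  ... | inj₂ h∈ | inj₂ k∈ = inj₁ (subst₂ _↝_ (opp-involutive h) (opp-involutive k)
    (↝-opp (↝-trans (↝-sym (∈tour⇒↝ h∈)) (∈tour⇒↝ k∈))))

  same-or-mate : ∀ {h k} → end k ≡ end h → h ↝ k ⊎ h ↝ mate k
  same-or-mate k-end with same-or-opposite k-end
  ... | inj₁ h↝k = inj₁ h↝k
  ... | inj₂ h↝k = inj₂ (↝-trans h↝k opp↝mate)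

  _↝?_ : ∀ h k → Dec (h ↝ k)
  h ↝? k = map′ ∈tour⇒↝ ↝⇒∈tour (k ∈? tour h)

  -- A circuit of C written as first ∷ before and second ∷ after, its two segments
  -- from v to v; `first` and `second` are the two half-edges along which it
  -- leaves v.
  record Cut (v : Vertex) : Set where
    field
      first second : HalfEdge
      first-end    : end first ≡ v
      second-end   : end second ≡ v
      before after : List HalfEdge
      tour≡        : tour first ≡ first ∷ before ++ second ∷ after

  cut : ∀ v → Cut v
  cut v with halfEdgeAt v
  ... | s , refl with second
    where
    second : ∃[ l ] (end l ≡ end s × l ≢ s × s ↝ l)
    second with thirdHalfEdge s (mate s)
    ... | l , l-end , l≢s , l≢ms with same-or-mate l-end
    ... | inj₁ s↝l  = l , l-end , l≢s , s↝l
    ... | inj₂ s↝ml = mate l , trans (mate-end l) l-end , mate-swap-≢ l≢ms , s↝ml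
  ... | l , l-end , l≢s , s↝l with ↝⇒∈tour s↝l
  ... | here l≡s = contradiction l≡s l≢s
  ... | there l∈ with ∈-∃++ l∈
  ... | xs , ys , eq = record
    { first-end = refl ; second-end = l-end ; tour≡ = cong (s ∷_) eq }

  module Segment {v : Vertex} (vCut : Cut v) where
    open Cut vCut

    private
      path : Path first ((first ∷ before) ++ second ∷ after) first
      path = subst (λ hs → Path first hs first) tour≡ (tour-path first)

      unique : Unique ((first ∷ before) ++ second ∷ after)
      unique = subst Unique tour≡ (tour-unique first)

      out : ∀ {h} → h ∈ (first ∷ before) ++ second ∷ after → first ↝ h
      out = path-∈ path

      out⁻¹ : ∀ {h} → first ↝ h → h ∈ first ∷ before ⊎ h ∈ second ∷ after
      out⁻¹ {h} first↝h = ∈-++⁻ (first ∷ before) (subst (h ∈_) tour≡ (↝⇒∈tour first↝h))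

      second∉ : second ∉ first ∷ before × second ∉ after × Unique after
      second∉ = unique-++-∉ (first ∷ before) unique

      first∉ : first ∉ before ++ second ∷ after
      first∉ = Unique[x∷xs]⇒x∉xs unique

      -- After its start at `first`, the circuit leaves v only along `second`.
      visits : ∀ {h} → h ∈ before ++ second ∷ after → v ≡ end h → h ≡ second
      visits h∈ v≡ = outs-at-most-two (trans second-end (sym first-end))
        (trans (sym v≡) (sym first-end))
        (out (∈-++⁺ʳ (first ∷ before) (here refl))) (out (there h∈))
        (λ { eq → second∉ .proj₁ (here eq) }) (λ { refl → first∉ h∈ })

      before-avoids : ∀ {h} → h ∈ before → v ≢ end h
      before-avoids h∈ v≡ with visits (∈-++⁺ˡ h∈) v≡
      ... | refl = second∉ .proj₁ (there h∈)

      after-avoids : ∀ {h} → h ∈ after → v ≢ end h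
      after-avoids h∈ v≡ with visits (∈-++⁺ʳ before (there h∈)) v≡
      ... | refl = second∉ .proj₂ .proj₁ h∈

    -- The indicator of the edges of the segment first ∷ before, on half-edges.
    seg : HalfEdge → Bool
    seg h = does (h ∈? first ∷ before) ∨ does (opp h ∈? first ∷ before)

    seg-opp : ∀ h → seg (opp h) ≡ seg h
    seg-opp h rewrite opp-involutive h =
      ∨-comm (does (opp h ∈? first ∷ before)) (does (h ∈? first ∷ before))

    private
      seg-member : ∀ {h} → h ∈ first ∷ before → seg h ≡ true
      seg-member {h} h∈ rewrite dec-true (h ∈? first ∷ before) h∈ = refl

      seg-nonmember : ∀ {h} → h ∉ first ∷ before → opp h ∉ first ∷ before → seg h ≡ false
      seg-nonmember {h} h∉ oh∉
        rewrite dec-false (h ∈? first ∷ before) h∉ | dec-false (opp h ∈? first ∷ before) oh∉ = refl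

      seg-after : ∀ {h} → h ∈ second ∷ after → seg h ≡ false
      seg-after {h} h∈ = seg-nonmember
        (λ h∈′ → disjoint (first ∷ before) unique h∈′ h∈)
        (λ oh∈ → ¬↝opp (↝-trans (↝-sym (out (∈-++⁺ʳ (first ∷ before) h∈))) (out (∈-++⁺ˡ oh∈))))
        where
        disjoint : ∀ xs {ys} → Unique (xs ++ ys) → ∀ {l} → l ∈ xs → l ∉ ys
        disjoint (x ∷ xs) (x∉ ∷ _) (here refl) l∈ = All.lookup x∉ (∈-++⁺ʳ xs l∈) refl
        disjoint (x ∷ xs) (_ ∷ u)  (there l∈′) l∈ = disjoint xs u l∈′ l∈

      seg-true : ∀ {h} → seg h ≡ true → first ↝ h ⊎ first ↝ opp h
      seg-true {h} eq with h ∈? first ∷ before | opp h ∈? first ∷ before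
      ... | yes h∈ | _      = inj₁ (out (∈-++⁺ˡ h∈))
      ... | no _   | yes h∈ = inj₂ (out (∈-++⁺ˡ h∈))
      ... | no h∉  | no oh∉ = contradiction (trans (sym eq) (seg-nonmember h∉ oh∉)) λ ()

      seg-outside : ∀ {h} → h ∉ tour first → opp h ∉ tour first → seg h ≡ false
      seg-outside h∉ oh∉ = seg-nonmember (h∉ ∘ ↝⇒∈tour ∘ out ∘ ∈-++⁺ˡ) (oh∉ ∘ ↝⇒∈tour ∘ out ∘ ∈-++⁺ˡ)

      seg-next-out : ∀ {h} → first ↝ h → seg (next h) ≡ seg h xor does (v ≟ end (next h))
      seg-next-out {h} first↝h with out⁻¹ first↝h
      ... | inj₁ h∈ with path-next (path-split (first ∷ before) path .proj₁) h∈
      ...   | inj₁ n∈ rewrite seg-member h∈ | seg-member (there n∈)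
                      | dec-false (v ≟ end (next h)) (before-avoids n∈) = refl
      ...   | inj₂ eq rewrite seg-member h∈ | eq | seg-after {second} (here refl)
                      | dec-true (v ≟ end second) (sym second-end) = refl
      seg-next-out {h} first↝h | inj₂ h∈
        with path-next (second ∷ path-split (first ∷ before) path .proj₂) h∈
      ...   | inj₁ n∈ rewrite seg-after h∈ | seg-after (there n∈)
                      | dec-false (v ≟ end (next h)) (after-avoids n∈) = refl
      ...   | inj₂ eq rewrite seg-after h∈ | eq | seg-member {first} (here refl)
                      | dec-true (v ≟ end first) (sym first-end) = refl

    -- Following the circuits of C, the indicator changes exactly on passing v.
    seg-next : ∀ h → seg (next h) ≡ seg h xor does (v ≟ end (next h))
    seg-next h with h ∈? tour first | opp h ∈? tour first
    ... | yes h∈ | _ = seg-next-out (∈tour⇒↝ h∈)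
    -- On the reversed circuit, apply `seg-next-out` to opp (next h),
    -- whose successor is opp h.
    ... | no _ | yes oh∈ = begin
      seg (next h)                          ≡⟨ seg-opp (next h) ⟨
      seg k                                 ≡⟨ xor-cancelʳ (seg k) δ ⟨
      (seg k xor δ) xor δ                   ≡⟨ cong (λ x → (seg k xor does (v ≟ x)) xor δ) ends ⟨
      (seg k xor does (v ≟ end (next k))) xor δ
        ≡⟨ cong (_xor δ) (seg-next-out (↝-trans (∈tour⇒↝ oh∈) (↝-sym (1 , next-opp-next h)))) ⟨
      seg (next k) xor δ                    ≡⟨ cong (λ x → seg x xor δ) (next-opp-next h) ⟩
      seg (opp h) xor δ                     ≡⟨ cong (_xor δ) (seg-opp h) ⟩
      seg h xor δ ∎
      where
      open ≡-Reasoning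
      k : HalfEdge
      k = opp (next h)
      δ : Bool
      δ = does (v ≟ end (next h))
      ends : end (next k) ≡ end (next h)
      ends = trans (cong end (next-opp-next h)) (sym (mate-end (opp h)))
    ... | no h∉ | no oh∉ = trans (seg-outside n∉ on∉) (sym (cong₂ _xor_ (seg-outside h∉ oh∉)
        (dec-false (v ≟ end (next h)) elsewhere)))
      where
      n∉ : next h ∉ tour first
      n∉ n∈ = h∉ (↝⇒∈tour (↝-trans (∈tour⇒↝ n∈) next-↝))
      on∉ : opp (next h) ∉ tour first
      on∉ on∈ = oh∉ (↝⇒∈tour (↝-trans (∈tour⇒↝ on∈) (1 , next-opp-next h)))
      elsewhere : v ≢ end (next h)
      elsewhere v≡ with same-or-opposite {first} {next h} (trans (sym v≡) (sym first-end))
      ... | inj₁ f↝ = n∉ (↝⇒∈tour f↝)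
      ... | inj₂ f↝ = on∉ (↝⇒∈tour f↝)

    -- The value of the indicator on the transition of C at end h is δ(v , end h).
    seg-mate : ∀ h → seg (mate h) ≡ seg h xor does (v ≟ end h)
    seg-mate h = subst₂ (λ k w → seg k ≡ seg h xor does (v ≟ w)) (next-opp h)
      (trans (cong end (next-opp h)) (mate-end h))
      (trans (seg-next (opp h)) (cong (_xor does (v ≟ end (next (opp h)))) (seg-opp h)))

    -- The indicator along a path whose interior does not meet v.
    path-seg : ∀ {h hs k} → Path (next h) hs k → (∀ {l} → l ∈ hs → v ≢ end l) →
               seg k ≡ seg h xor does (v ≟ end k)
    path-seg {h} [] _ = seg-next h
    path-seg {h} {k = k} (_ ∷ p) avoids = trans (path-seg p (avoids ∘ there))
      (cong (_xor does (v ≟ end k)) (begin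
        seg (next h)                          ≡⟨ seg-next h ⟩
        seg h xor does (v ≟ end (next h))
          ≡⟨ cong (seg h xor_) (dec-false (v ≟ end (next h)) (avoids (here refl))) ⟩
        seg h xor false                       ≡⟨ xor-identityʳ (seg h) ⟩
        seg h ∎))
      where open ≡-Reasoning

    private
      seg-pair-same : ∀ {h k h′ k′} → end k ≡ end h → end h′ ≡ end h → end k′ ≡ end h →
        h ↝ k → k ≢ h → h ↝ h′ → h′ ↝ k′ → k′ ≢ h′ →
        seg k xor seg h ≡ seg k′ xor seg h′
      seg-pair-same {h} {k} {h′} {k′} k-end h′-end k′-end h↝k k≢h h↝h′ h′↝k′ k′≢h′ with h′ ≟ h
      ... | yes refl = cong (λ x → seg x xor seg h)
        (outs-at-most-two k′-end k-end h′↝k′ h↝k k′≢h′ k≢h)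
      ... | no h′≢h with outs-at-most-two k-end h′-end h↝k h↝h′ k≢h h′≢h
      ... | refl = trans (xor-comm (seg k) (seg h)) (cong (λ x → seg x xor seg k)
        (outs-at-most-two (trans k′-end (sym k-end)) (sym k-end) h′↝k′ (↝-sym h↝k) k′≢h′ (k≢h ∘ sym)))

    seg-pair-mate : ∀ {h k} → end k ≡ end h → seg (mate k) xor seg (mate h) ≡ seg k xor seg h
    seg-pair-mate {h} {k} k-end = begin
      seg (mate k) xor seg (mate h)      ≡⟨ cong₂ _xor_ (seg-mate k) (seg-mate h) ⟩
      (seg k xor does (v ≟ end k)) xor (seg h xor δ)
        ≡⟨ cong (λ w → (seg k xor does (v ≟ w)) xor (seg h xor δ)) k-end ⟩
      (seg k xor δ) xor (seg h xor δ)    ≡⟨ interchange (seg k) δ (seg h) δ ⟩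
      (seg k xor seg h) xor (δ xor δ)    ≡⟨ cong ((seg k xor seg h) xor_) (xor-same δ) ⟩
      (seg k xor seg h) xor false        ≡⟨ xor-identityʳ _ ⟩
      seg k xor seg h ∎
      where
      open ≡-Reasoning
      δ : Bool
      δ = does (v ≟ end h)

    -- The difference of the indicator between two half-edges at a vertex that point
    -- in the same direction depends on the vertex alone: two pairs of this kind
    -- are equal up to order, or one is the image of the other under mate.
    seg-pair : ∀ {h k h′ k′} → end k ≡ end h → end h′ ≡ end h → end k′ ≡ end h →
               h ↝ k → k ≢ h → h′ ↝ k′ → k′ ≢ h′ →
               seg k xor seg h ≡ seg k′ xor seg h′
    seg-pair {h′ = h′} {k′} k-end h′-end k′-end h↝k k≢h h′↝k′ k′≢h′
      with same-or-mate h′-end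
    ... | inj₁ h↝h′  = seg-pair-same k-end h′-end k′-end h↝k k≢h h↝h′ h′↝k′ k′≢h′
    ... | inj₂ h↝mh′ = trans
      (seg-pair-same k-end (trans (mate-end h′) h′-end) (trans (mate-end k′) k′-end)
        h↝k k≢h h↝mh′ (↝-mate h′↝k′) (mate-cong-≢ k′≢h′))
      (seg-pair-mate (trans k′-end (sym h′-end)))

    -- On a tour that reads v x₂ v x₄ with x₂ and x₄ at w, the circuit leaves v only
    -- at the two listed places, so the indicator changes exactly once between x₂
    -- and x₄.
    interlaced⇒separated : ∀ {w} → Interlaced v w →
      ∃[ h ] ∃[ k ] (end h ≡ w × end k ≡ w × h ↝ k × seg k xor seg h ≡ true)
    interlaced⇒separated {w} (v≢w , t , sub) with ∷-⊆-map end (tour t) sub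
    ... | xs₁ , x₁ , ys₁ , tour-eq , x₁-end , sub₁ with ∷-⊆-map end ys₁ sub₁
    ... | xs₂ , x₂ , ys₂ , refl , x₂-end , sub₂ with ∷-⊆-map end ys₂ sub₂
    ... | xs₃ , x₃ , ys₃ , refl , x₃-end , sub₃ with ∷-⊆-map end ys₃ sub₃
    ... | xs₄ , x₄ , ys₄ , refl , x₄-end , _ =
      x₂ , x₄ , x₂-end , x₄-end , x₂↝x₄ , separated
      where
      p₁ : Path (next x₁) (xs₂ ++ x₂ ∷ xs₃ ++ x₃ ∷ xs₄ ++ x₄ ∷ ys₄) t
      p₁ = path-split xs₁ (subst (λ hs → Path t hs t) tour-eq (tour-path t)) .proj₂
      p₂ : Path (next x₂) (xs₃ ++ x₃ ∷ xs₄ ++ x₄ ∷ ys₄) t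
      p₂ = path-split xs₂ p₁ .proj₂
      p₃ : Path (next x₃) (xs₄ ++ x₄ ∷ ys₄) t
      p₃ = path-split xs₃ p₂ .proj₂
      u₁ : x₁ ∉ xs₁ × x₁ ∉ xs₂ ++ x₂ ∷ xs₃ ++ x₃ ∷ xs₄ ++ x₄ ∷ ys₄ ×
           Unique (xs₂ ++ x₂ ∷ xs₃ ++ x₃ ∷ xs₄ ++ x₄ ∷ ys₄)
      u₁ = unique-++-∉ xs₁ (subst Unique tour-eq (tour-unique t))
      u₃ : x₃ ∉ xs₃ × x₃ ∉ xs₄ ++ x₄ ∷ ys₄ × Unique (xs₄ ++ x₄ ∷ ys₄)
      u₃ = unique-++-∉ xs₃ (unique-++-∉ xs₂ (u₁ .proj₂ .proj₂) .proj₂ .proj₂)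
      x₂↝x₄ : x₂ ↝ x₄
      x₂↝x₄ = ↝-trans ↝-next (path-∈ p₂ (∈-++⁺ʳ xs₃ (there (∈-++⁺ʳ xs₄ (here refl)))))
      third-visit : ∀ {l} → l ∈ xs₃ ++ x₃ ∷ xs₄ ++ x₄ ∷ ys₄ → v ≡ end l → l ≡ x₃
      third-visit l∈ v≡ = outs-at-most-two (trans x₃-end (sym x₁-end)) (trans (sym v≡) (sym x₁-end))
        (x₁↝ (∈-++⁺ʳ xs₃ (here refl))) (x₁↝ l∈)
        (λ { refl → x₁∉ (∈-++⁺ʳ xs₃ (here refl)) }) (λ { refl → x₁∉ l∈ })
        where
        x₁∉ : x₁ ∉ xs₃ ++ x₃ ∷ xs₄ ++ x₄ ∷ ys₄
        x₁∉ = u₁ .proj₂ .proj₁ ∘ ∈-++⁺ʳ xs₂ ∘ there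
        x₁↝ : ∀ {l} → l ∈ xs₃ ++ x₃ ∷ xs₄ ++ x₄ ∷ ys₄ → x₁ ↝ l
        x₁↝ l∈ = ↝-trans ↝-next (path-∈ p₁ (∈-++⁺ʳ xs₂ (there l∈)))
      avoids₃ : ∀ {l} → l ∈ xs₃ → v ≢ end l
      avoids₃ l∈ v≡ with third-visit (∈-++⁺ˡ l∈) v≡
      ... | refl = u₃ .proj₁ l∈
      avoids₄ : ∀ {l} → l ∈ xs₄ → v ≢ end l
      avoids₄ l∈ v≡ with third-visit (∈-++⁺ʳ xs₃ (there (∈-++⁺ˡ l∈))) v≡
      ... | refl = u₃ .proj₂ .proj₁ (∈-++⁺ˡ l∈)
      separated : seg x₄ xor seg x₂ ≡ true
      separated = begin
        seg x₄ xor seg x₂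
          ≡⟨ cong (_xor seg x₂) (path-seg (path-split xs₄ p₃ .proj₁) avoids₄) ⟩
        (seg x₃ xor does (v ≟ end x₄)) xor seg x₂
          ≡⟨ cong₂ (λ a b → (a xor b) xor seg x₂) (path-seg (path-split xs₃ p₂ .proj₁) avoids₃)
               (dec-false (v ≟ end x₄) (λ v≡ → v≢w (trans v≡ x₄-end))) ⟩
        ((seg x₂ xor does (v ≟ end x₃)) xor false) xor seg x₂
          ≡⟨ cong (λ a → ((seg x₂ xor a) xor false) xor seg x₂)
               (dec-true (v ≟ end x₃) (sym x₃-end)) ⟩
        ((seg x₂ xor true) xor false) xor seg x₂
          ≡⟨ flip-once (seg x₂) ⟩
        true ∎
        where
        open ≡-Reasoning
        flip-once : ∀ b → ((b xor true) xor false) xor b ≡ true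
        flip-once false = refl
        flip-once true  = refl

    private
      -- One departure from w in each of the two segments exhibits v w v w on the
      -- tour from `first`.
      separated-out : ∀ {h k w} → v ≢ w → end h ≡ w → end k ≡ w → first ↝ h → first ↝ k →
                      seg h ≡ true → seg k ≡ false → Interlaced v w
      separated-out {h} {k} {w} v≢w h-end k-end f↝h f↝k seg-h seg-k =
        v≢w , first , subst (λ hs → (v ∷ w ∷ v ∷ w ∷ []) ⊆ map end hs) (sym tour≡)
          (sym first-end ∷ subst (λ x → (x ∷ v ∷ x ∷ []) ⊆ map end (before ++ second ∷ after)) h-end
            (∈-++-⊆-map end before (h∈before (out⁻¹ f↝h))
              (sym second-end ∷ subst (λ x → (x ∷ []) ⊆ map end after) (trans k-end (sym h-end))
                (from∈ (∈-map⁺ end (k∈after (out⁻¹ f↝k)))))))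
        where
        h∈before : h ∈ first ∷ before ⊎ h ∈ second ∷ after → h ∈ before
        h∈before (inj₁ (here refl)) = contradiction (trans (sym first-end) h-end) v≢w
        h∈before (inj₁ (there h∈))  = h∈
        h∈before (inj₂ h∈)          = contradiction (trans (sym seg-h) (seg-after h∈)) λ ()
        k∈after : k ∈ first ∷ before ⊎ k ∈ second ∷ after → k ∈ after
        k∈after (inj₂ (here refl)) = contradiction (trans (sym second-end) k-end) v≢w
        k∈after (inj₂ (there k∈))  = k∈
        k∈after (inj₁ k∈)          = contradiction (trans (sym seg-k) (seg-member k∈)) λ ()

      separated-true : ∀ {h k w} → v ≢ w → end h ≡ w → end k ≡ w → h ↝ k →
                       seg h ≡ true → seg k ≡ false → Interlaced v w
      separated-true {h} {k} {w} v≢w h-end k-end h↝k seg-h seg-k with seg-true {h} seg-h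
      ... | inj₁ f↝h  = separated-out v≢w h-end k-end f↝h (↝-trans f↝h h↝k) seg-h seg-k
      ... | inj₂ f↝oh = separated-out v≢w (trans (mate-end h) h-end) (trans (mate-end k) k-end)
        f↝mh (↝-trans f↝mh (↝-mate h↝k)) (trans (seg-mate′ h-end) seg-h) (trans (seg-mate′ k-end) seg-k)
        where
        f↝mh : first ↝ mate h
        f↝mh = ↝-trans f↝oh opp↝mate
        seg-mate′ : ∀ {l} → end l ≡ w → seg (mate l) ≡ seg l
        seg-mate′ {l} l-end = trans (seg-mate l) (trans
          (cong (seg l xor_) (dec-false (v ≟ end l) (λ v≡ → v≢w (trans v≡ l-end))))
          (xor-identityʳ (seg l)))

    separated⇒interlaced : ∀ {h k w} → v ≢ w → end h ≡ w → end k ≡ w → h ↝ k →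
                           seg k xor seg h ≡ true → Interlaced v w
    separated⇒interlaced {h} {k} v≢w h-end k-end h↝k sep
      with seg h in seg-h | seg k in seg-k
    ... | true  | false = separated-true v≢w h-end k-end h↝k seg-h seg-k
    ... | false | true  = separated-true v≢w k-end h-end (↝-sym h↝k) seg-k seg-h
    ... | true  | true  = contradiction sep λ ()
    ... | false | false = contradiction sep λ ()

    -- Two half-edges in the same direction at v lie in different segments.
    separation-self : ∀ {h k} → end h ≡ v → end k ≡ v → h ↝ k → k ≢ h → seg k xor seg h ≡ true
    separation-self h-end k-end h↝k k≢h = trans
      (seg-pair (trans k-end (sym h-end)) (trans first-end (sym h-end)) (trans second-end (sym h-end))
        h↝k k≢h (out (∈-++⁺ʳ (first ∷ before) (here refl))) (λ eq → second∉ .proj₁ (here eq)))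
      (cong₂ _xor_ (seg-after {second} (here refl)) (seg-member {first} (here refl)))

    separation-other : ∀ {h k w} → v ≢ w → end h ≡ w → end k ≡ w → h ↝ k → k ≢ h →
                       seg k xor seg h ≡ interlacement C v w
    separation-other {h} {k} {w} v≢w h-end k-end h↝k k≢h = go (interlaced? v w)
      where
      go : Dec (Interlaced v w) → seg k xor seg h ≡ interlacement C v w
      go (no ¬vw) = trans (¬-not (¬vw ∘ separated⇒interlaced v≢w h-end k-end h↝k))
        (sym (entry-false (interlaced? v w) ¬vw))
      go (yes vw) with interlaced⇒separated vw
      ... | h′ , k′ , h′-end , k′-end , h′↝k′ , sep = trans
        (seg-pair (trans k-end (sym h-end)) (trans h′-end (sym h-end)) (trans k′-end (sym h-end))
          h↝k k≢h h′↝k′ λ { refl → contradiction (trans (sym (xor-same (seg h′))) sep) λ () })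
        (trans sep (sym (entry-true (interlaced? v w) vw)))

  -- Transition labels and the rows of the relative interlacement matrix

  module Labels (P : CircuitPartition F) where
    private
      module P = CircuitPartition P

    -- With one pair of the transition of C at a vertex, P also has the other pair.
    follows⇒φ : ∀ {h} → P.mate h ≡ mate h → Involvesφ C P (end h)
    follows⇒φ {h} eq k k-end with k ≟ h | k ≟ mate h
    ... | yes refl | _        = eq
    ... | no _     | yes refl = begin
      P.mate (mate h)   ≡⟨ cong P.mate eq ⟨
      P.mate (P.mate h) ≡⟨ P.mate-involutive h ⟩
      h                 ≡⟨ mate-involutive h ⟨
      mate (mate h)     ∎
      where open ≡-Reasoning
    ... | no k≢h   | no k≢mh = fourth k-end (trans (P.mate-end k) k-end) k≢h k≢mh
      (λ Pk≡h → k≢mh (trans (sym (P.mate-involutive k)) (trans (cong P.mate Pk≡h) eq)))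
      (λ Pk≡mh → k≢h (Circuits.mate-injective P (trans Pk≡mh (sym eq))))
      (P.mate-irreflexive k)

    -- If P pairs one half-edge at a vertex with one of the same direction, it pairs
    -- the remaining two, which have the opposite direction.
    codirected⇒ψ : ∀ {h} → h ↝ P.mate h → Involvesψ C P (end h)
    codirected⇒ψ {h} h↝Ph s _ k k-end =
      (λ k∈ → ↝⇒∈tour (↝-trans (∈tour⇒↝ k∈) k↝Pk)) ,
      (λ k∈ → ↝⇒∈tour (↝-trans (∈tour⇒↝ k∈) (↝-opp k↝Pk)))
      where
      third : ∀ {l} → end l ≡ end h → l ≢ h → l ≢ P.mate h → h ↝ mate l
      third l-end l≢h l≢Ph with same-or-mate l-end
      ... | inj₂ h↝ml = h↝ml
      ... | inj₁ h↝l = contradiction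
        (outs-at-most-two (P.mate-end h) l-end h↝Ph h↝l (P.mate-irreflexive h) l≢h) l≢Ph
      k↝Pk : k ↝ P.mate k
      k↝Pk with k ≟ h | k ≟ P.mate h
      ... | yes refl | _        = h↝Ph
      ... | no _     | yes refl = subst (P.mate h ↝_) (sym (P.mate-involutive h)) (↝-sym h↝Ph)
      ... | no k≢h   | no k≢Ph  = subst₂ _↝_ (mate-involutive k) (mate-involutive (P.mate k))
        (↝-mate (↝-trans (↝-sym (third k-end k≢h k≢Ph)) (third (trans (P.mate-end k) k-end)
          (λ Pk≡h → k≢Ph (trans (sym (P.mate-involutive k)) (cong P.mate Pk≡h)))
          (k≢h ∘ Circuits.mate-injective P))))

    ψ⇒codirected : ∀ {h} → Involvesψ C P (end h) → h ↝ P.mate h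
    ψ⇒codirected {h} ψ = ∈tour⇒↝ (ψ h refl h refl .proj₁ (here refl))

    φ-row : ∀ {v} → Involvesφ C P v → ∀ w → 𝓘[ P ] C v w ≡ 𝟙 v w
    φ-row {v} φ w = cong (λ a → if does (v ≟ w)
        then (if a ∨ does (involvesψ? C P v) then true else interlacement C v v)
        else (if a ∨ does (involvesφ? C P w) then false else interlacement C v w))
      (dec-true (involvesφ? C P v) φ)

    module _ {v : Vertex} (vCut : Cut v) (¬φ : ¬ Involvesφ C P v) where
      open Segment vCut

      private
        diagonal : 𝓘[ P ] C v v ≡ does (involvesψ? C P v)
        diagonal = begin
          𝓘[ P ] C v v
            ≡⟨ cong (if_then (if φ ∨ ψ then true else interlacement C v v)
                     else (if φ ∨ φ then false else interlacement C v v)) (dec-true (v ≟ v) refl) ⟩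
          (if φ ∨ ψ then true else interlacement C v v)
            ≡⟨ cong₂ (λ a b → if a ∨ ψ then true else b) (dec-false (involvesφ? C P v) ¬φ)
                 (entry-false (interlaced? v v) λ vv → vv .proj₁ refl) ⟩
          (if ψ then true else false) ≡⟨ if-id ψ ⟩
          ψ ∎
          where
          open ≡-Reasoning
          φ ψ : Bool
          φ = does (involvesφ? C P v)
          ψ = does (involvesψ? C P v)

        off-diagonal : ∀ {w} → v ≢ w →
          𝓘[ P ] C v w ≡ (if does (involvesφ? C P w) then false else interlacement C v w)
        off-diagonal {w} v≢w = begin
          𝓘[ P ] C v w
            ≡⟨ cong (if_then (if φv ∨ ψv then true else interlacement C v v)
                     else (if φv ∨ φw then false else interlacement C v w)) (dec-false (v ≟ w) v≢w) ⟩
          (if φv ∨ φw then false else interlacement C v w)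
            ≡⟨ cong (λ a → if a ∨ φw then false else interlacement C v w)
                 (dec-false (involvesφ? C P v) ¬φ) ⟩
          (if φw then false else interlacement C v w) ∎
          where
          open ≡-Reasoning
          φv φw ψv : Bool
          φv = does (involvesφ? C P v)
          φw = does (involvesφ? C P w)
          ψv = does (involvesψ? C P v)

      -- A vertex w where P follows C contributes nothing to the row of v.
      φ-column : ∀ {w} → Involvesφ C P w → 𝓘[ P ] C v w ≡ false
      φ-column {w} φw = trans (off-diagonal λ { refl → ¬φ φw })
        (cong (if_then false else interlacement C v w) (dec-true (involvesφ? C P w) φw))

      private
        -- Compare P.mate h with h through mate (P.mate h), which points in the
        -- direction of h when P.mate h does not.
        transverse : ∀ {h} → seg (P.mate h) xor seg h ≡
          (seg (mate (P.mate h)) xor seg h) xor does (v ≟ end h)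
        transverse {h} = begin
          seg Ph xor seg h                       ≡⟨ xor-cancelʳ _ δ ⟨
          ((seg Ph xor seg h) xor δ) xor δ       ≡⟨ cong (_xor δ) (xor-assoc (seg Ph) (seg h) δ) ⟩
          (seg Ph xor (seg h xor δ)) xor δ
            ≡⟨ cong (λ a → (seg Ph xor a) xor δ) (xor-comm (seg h) δ) ⟩
          (seg Ph xor (δ xor seg h)) xor δ       ≡⟨ cong (_xor δ) (xor-assoc (seg Ph) δ (seg h)) ⟨
          ((seg Ph xor δ) xor seg h) xor δ
            ≡⟨ cong (λ w → ((seg Ph xor does (v ≟ w)) xor seg h) xor δ) (P.mate-end h) ⟨
          ((seg Ph xor does (v ≟ end Ph)) xor seg h) xor δ
            ≡⟨ cong (λ a → (a xor seg h) xor δ) (seg-mate Ph) ⟨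
          (seg (mate Ph) xor seg h) xor δ ∎
          where
          open ≡-Reasoning
          Ph : HalfEdge
          Ph = P.mate h
          δ : Bool
          δ = does (v ≟ end h)

        -- On the diagonal: the value is 1 on ψ, where P.mate h has the direction of h,
        -- and 1 + 1 = 0 on χ.
        self : ∀ {h} → v ≡ end h → seg (P.mate h) xor seg h ≡ 𝓘[ P ] C v v
        self {h} v≡ = trans (go (h ↝? P.mate h)) (sym diagonal)
          where
          go : Dec (h ↝ P.mate h) → seg (P.mate h) xor seg h ≡ does (involvesψ? C P v)
          go (yes h↝Ph) = trans
            (separation-self (sym v≡) (trans (P.mate-end h) (sym v≡)) h↝Ph (P.mate-irreflexive h))
            (sym (dec-true (involvesψ? C P v)
              (subst (Involvesψ C P) (sym v≡) (codirected⇒ψ h↝Ph))))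
          go (no ¬h↝Ph) with same-or-mate (P.mate-end h)
          ... | inj₁ h↝Ph  = contradiction h↝Ph ¬h↝Ph
          ... | inj₂ h↝mPh = begin
            seg (P.mate h) xor seg h                 ≡⟨ transverse ⟩
            (seg (mate (P.mate h)) xor seg h) xor does (v ≟ end h)
              ≡⟨ cong₂ _xor_ (separation-self (sym v≡)
                   (trans (mate-end (P.mate h)) (trans (P.mate-end h) (sym v≡))) h↝mPh mPh≢h)
                   (dec-true (v ≟ end h) v≡) ⟩
            false                                    ≡⟨ dec-false (involvesψ? C P v) ¬ψ ⟨
            does (involvesψ? C P v) ∎
            where
            open ≡-Reasoning
            mPh≢h : mate (P.mate h) ≢ h
            mPh≢h eq = ¬φ (subst (Involvesφ C P) (sym v≡)
              (follows⇒φ (trans (sym (mate-involutive (P.mate h))) (cong mate eq))))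
            ¬ψ : ¬ Involvesψ C P v
            ¬ψ ψ = ¬h↝Ph (ψ⇒codirected (subst (Involvesψ C P) v≡ ψ))

        -- Off the diagonal: the value is 0 on φ, and on χ and ψ it is the interlacement.
        other : ∀ {h} → v ≢ end h → seg (P.mate h) xor seg h ≡ 𝓘[ P ] C v (end h)
        other {h} v≢ = go (P.mate h ≟ mate h)
          where
          open ≡-Reasoning
          δ≡ : does (v ≟ end h) ≡ false
          δ≡ = dec-false (v ≟ end h) v≢
          go : Dec (P.mate h ≡ mate h) → seg (P.mate h) xor seg h ≡ 𝓘[ P ] C v (end h)
          go (yes eq) = begin
            seg (P.mate h) xor seg h   ≡⟨ cong (λ k → seg k xor seg h) eq ⟩
            seg (mate h) xor seg h     ≡⟨ cong (_xor seg h) (trans (seg-mate h)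
                                            (trans (cong (seg h xor_) δ≡) (xor-identityʳ (seg h)))) ⟩
            seg h xor seg h            ≡⟨ xor-same (seg h) ⟩
            false                      ≡⟨ φ-column (follows⇒φ eq) ⟨
            𝓘[ P ] C v (end h) ∎
          go (no Ph≢mh) = trans separated (sym (trans (off-diagonal v≢)
            (cong (if_then false else interlacement C v (end h))
              (dec-false (involvesφ? C P (end h)) λ φ → Ph≢mh (φ h refl)))))
            where
            separated : seg (P.mate h) xor seg h ≡ interlacement C v (end h)
            separated with same-or-mate (P.mate-end h)
            ... | inj₁ h↝Ph  =
              separation-other v≢ refl (P.mate-end h) h↝Ph (P.mate-irreflexive h)
            ... | inj₂ h↝mPh = begin
              seg (P.mate h) xor seg h                 ≡⟨ transverse ⟩
              (seg (mate (P.mate h)) xor seg h) xor does (v ≟ end h)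
                ≡⟨ cong₂ _xor_ (separation-other v≢ refl
                     (trans (mate-end (P.mate h)) (P.mate-end h)) h↝mPh
                     (λ eq → Ph≢mh (trans (sym (mate-involutive (P.mate h))) (cong mate eq)))) δ≡ ⟩
              interlacement C v (end h) xor false      ≡⟨ xor-identityʳ _ ⟩
              interlacement C v (end h) ∎

      -- The row of v in 𝓘[ P ] C lists the values of the segment indicator on the
      -- transitions of P, provided that P does not follow C at v.
      seg-transition : ∀ h → seg (P.mate h) xor seg h ≡ 𝓘[ P ] C v (end h)
      seg-transition h = go (v ≟ end h)
        where
        go : Dec (v ≡ end h) → seg (P.mate h) xor seg h ≡ 𝓘[ P ] C v (end h)
        go (yes v≡) = trans (self v≡) (cong (𝓘[ P ] C v) v≡)
        go (no v≢)  = other v≢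

------------------------------------------------------------------------
-- The product of the relative interlacement matrices

𝟙-diagonal : ∀ {n} (i : Fin n) → 𝟙 i i ≡ true
𝟙-diagonal i = entry-true (i ≟ i) refl

𝟙-off-diagonal : ∀ {n} {i j : Fin n} → i ≢ j → 𝟙 i j ≡ false
𝟙-off-diagonal {i = i} {j} i≢j = entry-false (i ≟ j) i≢j

sum-𝟙ˡ : ∀ {n} (i : Fin n) (g : Fin n → Bool) → sum (λ j → 𝟙 i j ∧ g j) ≡ g i
sum-𝟙ˡ i g = trans
  (sum-single _ i λ j j≢i → cong (_∧ g j) (𝟙-off-diagonal (j≢i ∘ sym)))
  (cong (_∧ g i) (𝟙-diagonal i))

sum-𝟙ʳ : ∀ {n} (g : Fin n → Bool) (k : Fin n) → sum (λ j → g j ∧ does (j ≟ k)) ≡ g k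
sum-𝟙ʳ g k = trans
  (sum-single _ k λ j j≢k → trans (cong (g j ∧_) (dec-false (j ≟ k) j≢k)) (∧-zeroʳ (g j)))
  (trans (cong (g k ∧_) (dec-true (k ≟ k) refl)) (∧-identityʳ (g k)))

xor-exchange : ∀ a b c d → a xor b ≡ c xor d → a xor c ≡ b xor d
xor-exchange a b c d eq = begin
  a xor c                     ≡⟨ xor-cancelʳ (a xor c) (b xor d) ⟨
  ((a xor c) xor (b xor d)) xor (b xor d) ≡⟨ cong (_xor (b xor d)) (interchange a c b d) ⟩
  ((a xor b) xor (c xor d)) xor (b xor d) ≡⟨ cong (λ e → (e xor (c xor d)) xor (b xor d)) eq ⟩
  ((c xor d) xor (c xor d)) xor (b xor d) ≡⟨ cong (_xor (b xor d)) (xor-same (c xor d)) ⟩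
  b xor d ∎
  where open ≡-Reasoning

module Product (F : Multigraph) (regular : FourRegular F) (C C′ : CircuitPartition F)
               (euler : EulerSystem C) (euler′ : EulerSystem C′) where
  open Multigraph F
  private
    module C  = CircuitPartition C
    module C′ = CircuitPartition C′
    module E  = Eulerian F regular C euler
    module E′ = Eulerian F regular C′ euler′
    module N′ = Circuits C′
    M M′ : Matrix nV
    M  = 𝓘[ C′ ] C
    M′ = 𝓘[ C ] C′
    -- The segment indicators of C and of C′.
    f f′ : Vertex → HalfEdge → Bool
    f  v = E.Segment.seg (E.cut v)
    f′ v = E′.Segment.seg (E′.cut v)

  module _ {v : Vertex} (¬φ : ¬ Involvesφ C C′ v) where

    -- The combination of the segment indicators of C′ with coefficients row v of M.
    combination : HalfEdge → Bool
    combination h = sum λ w → M v w ∧ f′ w h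

    combination-xor : ∀ h k → combination k xor combination h ≡
                      sum (λ w → M v w ∧ (f′ w k xor f′ w h))
    combination-xor h k = trans (sym (∑-distrib-+ (λ w → M v w ∧ f′ w k) (λ w → M v w ∧ f′ w h)))
      (sum-cong-≗ λ w → sym (∧-distribˡ-xor (M v w) (f′ w k) (f′ w h)))

    seg-mate-xor : ∀ h w → f′ w (C′.mate h) xor f′ w h ≡ does (w ≟ end h)
    seg-mate-xor h w = begin
      f′ w (C′.mate h) xor f′ w h
        ≡⟨ cong (_xor f′ w h) (trans (E′.Segment.seg-mate (E′.cut w) h) (xor-comm (f′ w h) _)) ⟩
      (does (w ≟ end h) xor f′ w h) xor f′ w h   ≡⟨ xor-cancelʳ _ (f′ w h) ⟩
      does (w ≟ end h) ∎
      where open ≡-Reasoning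

    -- The function g = f v + Σ_w M v w · f′ w, which is constant along the
    -- circuits of C′ and hence at each vertex.
    difference : HalfEdge → Bool
    difference h = f v h xor combination h

    difference-opp : ∀ h → difference (opp h) ≡ difference h
    difference-opp h = cong₂ _xor_ (E.Segment.seg-opp (E.cut v) h)
      (sum-cong-≗ λ w → cong (M v w ∧_) (E′.Segment.seg-opp (E′.cut w) h))

    difference-mate : ∀ h → difference (C′.mate h) ≡ difference h
    difference-mate h = xor-exchange (f v (C′.mate h)) (f v h) (combination (C′.mate h)) (combination h) (begin
      f v (C′.mate h) xor f v h                         ≡⟨ E.Labels.seg-transition C′ (E.cut v) ¬φ h ⟩
      M v (end h)                                       ≡⟨ sum-𝟙ʳ (M v) (end h) ⟨
      sum (λ w → M v w ∧ does (w ≟ end h))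
        ≡⟨ sum-cong-≗ (λ w → cong (M v w ∧_) (seg-mate-xor h w)) ⟨
      sum (λ w → M v w ∧ (f′ w (C′.mate h) xor f′ w h)) ≡⟨ combination-xor h (C′.mate h) ⟨
      combination (C′.mate h) xor combination h ∎)
      where open ≡-Reasoning

    difference-circuit : ∀ {h k} → h N′.↝ k → difference k ≡ difference h
    difference-circuit (zero  , refl) = refl
    difference-circuit {h} (suc n , eq) = trans (difference-circuit (n , eq))
      (trans (difference-mate (opp h)) (difference-opp h))

    difference-vertex : ∀ {h k} → end k ≡ end h → difference k ≡ difference h
    difference-vertex {k = k} k-end with E′.same-or-opposite k-end
    ... | inj₁ h↝k = difference-circuit h↝k
    ... | inj₂ h↝k = trans (sym (difference-opp k)) (difference-circuit h↝k)

    product-row : ∀ u → (M ⊗ M′) v u ≡ 𝟙 v u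
    product-row u with Valency.halfEdgeAt F regular u
    ... | h , refl = begin
      sum (λ w → M v w ∧ M′ w (end h))                  ≡⟨ sum-cong-≗ term ⟨
      sum (λ w → M v w ∧ (f′ w (C.mate h) xor f′ w h))  ≡⟨ combination-xor h (C.mate h) ⟨
      combination (C.mate h) xor combination h
        ≡⟨ xor-exchange (f v (C.mate h)) (combination (C.mate h)) (f v h) (combination h)
             (difference-vertex (C.mate-end h)) ⟨
      f v (C.mate h) xor f v h
        ≡⟨ cong (_xor f v h) (trans (E.Segment.seg-mate (E.cut v) h) (xor-comm (f v h) _)) ⟩
      (does (v ≟ end h) xor f v h) xor f v h            ≡⟨ xor-cancelʳ _ (f v h) ⟩
      does (v ≟ end h)                                  ≡⟨ if-id _ ⟨
      𝟙 v (end h) ∎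
      where
      open ≡-Reasoning
      term : ∀ w → M v w ∧ (f′ w (C.mate h) xor f′ w h) ≡ M v w ∧ M′ w (end h)
      term w = go (involvesφ? C C′ w)
        where
        go : Dec (Involvesφ C C′ w) →
             M v w ∧ (f′ w (C.mate h) xor f′ w h) ≡ M v w ∧ M′ w (end h)
        go (no ¬φw) = cong (M v w ∧_)
          (E′.Labels.seg-transition C (E′.cut w) (λ φ′ → ¬φw λ k k-end → sym (φ′ k k-end)) h)
        go (yes φw) rewrite E.Labels.φ-column C′ (E.cut v) ¬φ φw = refl

  product : M ⊗ M′ ≐ 𝟙
  product v u = go (involvesφ? C C′ v)
    where
    go : Dec (Involvesφ C C′ v) → (M ⊗ M′) v u ≡ 𝟙 v u
    go (no ¬φ) = product-row ¬φ u
    go (yes φ) = begin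
      sum (λ w → M v w ∧ M′ w u)    ≡⟨ sum-cong-≗ (λ w → cong (_∧ M′ w u) (E.Labels.φ-row C′ φ w)) ⟩
      sum (λ w → 𝟙 v w ∧ M′ w u)    ≡⟨ sum-𝟙ˡ v (λ w → M′ w u) ⟩
      M′ v u                        ≡⟨ E′.Labels.φ-row C (λ k k-end → sym (φ k k-end)) u ⟩
      𝟙 v u ∎
      where open ≡-Reasoning

theorem17 : (F : Multigraph) → FourRegular F →
    (C C′ : CircuitPartition F) → EulerSystem C → EulerSystem C′ →
    IsInverse (𝓘[ C′ ] C) (𝓘[ C ] C′)
theorem17 F regular C C′ euler euler′ =
  Product.product F regular C C′ euler euler′ , Product.product F regular C′ C euler′ euler
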